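{- For integers $k,n\ge0$ let $A_k(n)$ be the number of $k$-arrangements of $[n]$. Then: 1. $A_k(0)=1$ and, for $n>0$, $A_k(n)=n\,A_k(n-1)+(k-1)^n$. 2. $\displaystyle\sum_{n\ge0}A_k(n)\frac{x^n}{n!}=\frac{e^{(k-1)x}}{1-x}$. 3. $A_k(n)$ equals the permanent of the $n\times n$ matrix with $k$ on the diagonal and $1$s elsewhere. 4. For $k\ge1$, the sequence $(A_k(n))_{n\ge0}$ is the binomial transform of $(A_{k-1}(n))_{n\ge0}$, that is, $A_k(n)=\sum_{i\ge0}\binom{n}{i}A_{k-1}(i)$.
   Context: $[n]=\{1,\dots,n\}$. For $k\ge1$, a $k$-arrangement of $[n]$ is a pair $(\pi,\phi)$ where $\pi$ is a permutation of $[n]$ and $\phi:\mathsf{Fix}(\pi)\to[k]$ is an arbitrary map from the set of fixed points of $\pi$ to $[k]$. A $0$-arrangement of $[n]$ is a derangement of $[n]$ (a permutation with no fixed points). For $n=0$ there is exactly one $k$-arrangement, for every $k\ge0$. -}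

module Defs where

open import Algebra using (CommutativeRing)
import Algebra.Properties.CommutativeMonoid.Sum as MonoidSum
import Algebra.Properties.Semiring.Exp as SemiringExp
import Algebra.Properties.Semiring.Sum as SemiringSum
open import Axiom.UniquenessOfIdentityProofs using (module Decidable⇒UIP)
open import Data.Bool using (if_then_else_)
open import Data.Fin using (Fin; zero; suc; toℕ; punchIn)
open import Data.Fin.Permutation as Perm using (Permutation′; _⟨$⟩ʳ_)
open import Data.Fin.Properties as Fin using (_≟_; punchIn-injective)
open import Data.Integer using (+_)
open import Data.List using (List; []; _∷_; map; concatMap; cartesianProductWith; allFin; length)
open import Data.List.Membership.Propositional.Properties using (∈-allFin)
import Data.List.Membership.Setoid as Membership
open import Data.List.Membership.Setoid.Properties as Mem using (∈-cartesianProductWith⁺)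
open import Data.List.Relation.Binary.Disjoint.Setoid using (Disjoint)
open import Data.List.Relation.Unary.All as All using ([]; _∷_)
import Data.List.Relation.Unary.All.Properties as All
open import Data.List.Relation.Unary.AllPairs as AllPairs using ([]; _∷_)
import Data.List.Relation.Unary.AllPairs.Properties as AllPairs
open import Data.List.Relation.Unary.Any as Any using (here)
import Data.List.Relation.Unary.Any.Properties as Any
import Data.List.Relation.Unary.Enumerates.Setoid as Enumerates
open import Data.List.Relation.Unary.Unique.Propositional.Properties using (allFin⁺)
import Data.List.Relation.Unary.Unique.Setoid as Unique
import Data.List.Relation.Unary.Unique.Setoid.Properties as Uniqueₚ
open import Data.Nat as ℕ using (ℕ; zero; suc; _∸_; _!)
open import Data.Nat.Combinatorics using (_C_)
open import Data.Nat.ListAction using (sum)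
import Data.Nat.Properties as ℕ
open import Data.Product using (∃; _×_; _,_; proj₂; uncurry)
open import Data.Rational as ℚ using (ℚ; 0ℚ; 1ℚ; 1/_; _/_)
import Data.Rational.Properties as ℚ
open import Data.Vec as Vec using (Vec; _∷_; [])
open import Function using (_∘_; const)
open import Relation.Binary using (Setoid)
open import Relation.Binary.PropositionalEquality
open import Relation.Nullary using (Dec; yes; no; ¬_; does; contradiction; Irrelevant)

open Decidable⇒UIP using (≡-irrelevant)

module ℕΣ = SemiringSum ℕ.+-*-semiring
module ℕΠ = MonoidSum ℕ.*-1-commutativeMonoid
module ℚΣ = SemiringSum (CommutativeRing.semiring ℚ.+-*-commutativeRing)
module ℚ^ = SemiringExp (CommutativeRing.semiring ℚ.+-*-commutativeRing)

private
  variable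
    k n : ℕ

Fix : Permutation′ n → Set
Fix π = ∃ λ i → π ⟨$⟩ʳ i ≡ i

-- For k = 0 the map into Fin 0 exists (uniquely) exactly when there is no
-- fixed point, so a 0-arrangement is a derangement; see `derangement⇒` and
-- `⇒derangement` below.
record Arrangement (k n : ℕ) : Set where
  constructor arrangement
  field
    perm   : Permutation′ n
    colour : Fix perm → Fin k

open Arrangement public

IsDerangement : Permutation′ n → Set
IsDerangement π = ∀ i → π ⟨$⟩ʳ i ≢ i

derangement⇒ : (π : Permutation′ n) → IsDerangement π → Arrangement 0 n
derangement⇒ π d = arrangement π λ (i , πi≡i) → contradiction πi≡i (d i)

⇒derangement : (a : Arrangement 0 n) → IsDerangement (perm a)
⇒derangement (arrangement π φ) i πi≡i = Fin.¬Fin0 (φ (i , πi≡i))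

-- Permutations and colourings are compared pointwise, so that each
-- mathematical k-arrangement is one equivalence class.
record _≈_ (a b : Arrangement k n) : Set where
  constructor mk≈
  field
    perm≈   : perm a Perm.≈ perm b
    colour≈ : ∀ i (p : perm a ⟨$⟩ʳ i ≡ i) (q : perm b ⟨$⟩ʳ i ≡ i) →
              colour a (i , p) ≡ colour b (i , q)

permutationSetoid : ℕ → Setoid _ _
permutationSetoid n = record
  { Carrier       = Permutation′ n
  ; _≈_           = Perm._≈_
  ; isEquivalence = record
    { refl  = λ _ → refl
    ; sym   = λ e i → sym (e i)
    ; trans = λ e f i → trans (e i) (f i)
    }
  }

arrangementSetoid : ℕ → ℕ → Setoid _ _
arrangementSetoid k n = record
  { Carrier       = Arrangement k n
  ; _≈_           = _≈_
  ; isEquivalence = record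
    { refl  = λ {a} → mk≈ (λ _ → refl) λ i p q → cong (λ r → colour a (i , r)) (≡-irrelevant _≟_ p q)
    ; sym   = λ (mk≈ e c) → mk≈ (λ i → sym (e i)) λ i p q → sym (c i q p)
    ; trans = λ (mk≈ e c) (mk≈ f d) → mk≈ (λ i → trans (e i) (f i)) λ i p q → trans (c i p (trans (sym (e i)) p)) (d i _ q)
    }
  }

-- A permutation of Fin (suc n) is determined by the image of zero and a
-- permutation of the remaining n points.
permutations : ∀ n → List (Permutation′ n)
permutations zero    = Perm.id ∷ []
permutations (suc n) = cartesianProductWith (Perm.insert zero) (allFin (suc n)) (permutations n)

permutations-enumerates : ∀ n → Enumerates.IsEnumeration (permutationSetoid n) (permutations n)
permutations-enumerates zero    π = here λ ()
permutations-enumerates (suc n) π =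
  Mem.∈-resp-≈ (permutationSetoid (suc n))
    {x = Perm.insert zero (π ⟨$⟩ʳ zero) (Perm.remove zero π)} {y = π} (Perm.insert-remove zero π)
    (∈-cartesianProductWith⁺ (setoid _) (permutationSetoid n) (permutationSetoid (suc n))
      (λ {i} {j} {ρ} {σ} → insert-cong {ρ = ρ} {σ})
      (∈-allFin (π ⟨$⟩ʳ zero)) (permutations-enumerates n (Perm.remove zero π)))
  where
  insert-cong : ∀ {i j : Fin (suc n)} {ρ σ : Permutation′ n} → i ≡ j → ρ Perm.≈ σ →
                Perm.insert zero i ρ Perm.≈ Perm.insert zero j σ
  insert-cong refl e zero    = refl
  insert-cong refl e (suc l) = cong (punchIn _) (e l)

permutations-unique : ∀ n → Unique.Unique (permutationSetoid n) (permutations n)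
permutations-unique zero    = [] ∷ []
permutations-unique (suc n) =
  Uniqueₚ.cartesianProductWith⁺ (setoid _) (permutationSetoid n) (permutationSetoid (suc n))
    (Perm.insert zero) (λ {i} {j} {ρ} {σ} → insert-injective {ρ = ρ} {σ}) (allFin⁺ (suc n)) (permutations-unique n)
  where
  insert-injective : ∀ {i j : Fin (suc n)} {ρ σ : Permutation′ n} →
                     Perm.insert zero i ρ Perm.≈ Perm.insert zero j σ → i ≡ j × ρ Perm.≈ σ
  insert-injective e with refl ← e zero = refl , λ l → punchIn-injective _ _ _ (e (suc l))

module _ (k : ℕ) where

  -- All maps P → Fin k, for P a proposition.
  maps : ∀ {P : Set} → Dec P → List (P → Fin k)
  maps (yes _) = map const (allFin k)
  maps (no ¬p) = (λ p → contradiction p ¬p) ∷ []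

  cons : ∀ {P : Fin (suc n) → Set} → (P zero → Fin k) → (∀ i → P (suc i) → Fin k) →
         ∀ i → P i → Fin k
  cons f g zero    = f
  cons f g (suc i) = g i

  families : ∀ {n} {P : Fin n → Set} → (∀ i → Dec (P i)) → List (∀ i → P i → Fin k)
  families {zero}  P? = (λ ()) ∷ []
  families {suc n} P? = cartesianProductWith cons (maps (P? zero)) (families (P? ∘ suc))

  colourings : (π : Permutation′ n) → List (Fix π → Fin k)
  colourings π = map uncurry (families (λ i → π ⟨$⟩ʳ i ≟ i))

arrangements : ∀ k n → List (Arrangement k n)
arrangements k n = concatMap (λ π → map (arrangement π) (colourings k π)) (permutations n)

-- The number of k-arrangements of an n-element set: `arrangements k n` lists
-- each of them exactly once, by `arrangements-enumerates` and
-- `arrangements-unique` below.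
A : ℕ → ℕ → ℕ
A k n = length (arrangements k n)

mapSetoid : ℕ → Set → Setoid _ _
mapSetoid k P = P →-setoid Fin k

familySetoid : ∀ k → (Fin n → Set) → Setoid _ _
familySetoid {n} k P = record
  { Carrier       = ∀ i → P i → Fin k
  ; _≈_           = λ f g → ∀ i p → f i p ≡ g i p
  ; isEquivalence = record
    { refl  = λ _ _ → refl
    ; sym   = λ e i p → sym (e i p)
    ; trans = λ e f i p → trans (e i p) (f i p)
    }
  }

module _ (k : ℕ) where

  maps-enumerates : ∀ {P : Set} (P? : Dec P) → Irrelevant P →
                    Enumerates.IsEnumeration (mapSetoid k P) (maps k P?)
  maps-enumerates (yes p) irr f =
    Any.map⁺ (Any.map (λ e q → trans (cong f (irr q p)) e) (∈-allFin (f p)))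
  maps-enumerates (no ¬p) irr f = here λ p → contradiction p ¬p

  maps-unique : ∀ {P : Set} (P? : Dec P) → Unique.Unique (mapSetoid k P) (maps k P?)
  maps-unique {P} (yes p) = Uniqueₚ.map⁺ (setoid _) (mapSetoid k P) (λ e → e p) (allFin⁺ k)
  maps-unique (no ¬p) = [] ∷ []

  families-enumerates : ∀ {n} {P : Fin n → Set} (P? : ∀ i → Dec (P i)) → (∀ i → Irrelevant (P i)) →
                        Enumerates.IsEnumeration (familySetoid k P) (families k P?)
  families-enumerates {zero}      P? irr f = here λ ()
  families-enumerates {suc n} {P} P? irr f =
    Mem.∈-resp-≈ (familySetoid k P) {y = f}
      (λ where zero p → refl
               (suc i) p → refl)
      (∈-cartesianProductWith⁺ (mapSetoid k (P zero)) (familySetoid k (P ∘ suc)) (familySetoid k P)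
        (λ where d e zero p → d p
                 d e (suc i) p → e i p)
        (maps-enumerates (P? zero) (irr zero) (f zero))
        (families-enumerates (P? ∘ suc) (irr ∘ suc) (f ∘ suc)))

  families-unique : ∀ {n} {P : Fin n → Set} (P? : ∀ i → Dec (P i)) →
                    Unique.Unique (familySetoid k P) (families k P?)
  families-unique {zero}      P? = [] ∷ []
  families-unique {suc n} {P} P? =
    Uniqueₚ.cartesianProductWith⁺ (mapSetoid k (P zero)) (familySetoid k (P ∘ suc)) (familySetoid k P)
      (cons k) (λ e → e zero , (e ∘ suc)) (maps-unique (P? zero)) (families-unique (P? ∘ suc))

arrangements-enumerates : ∀ k n → Enumerates.IsEnumeration (arrangementSetoid k n) (arrangements k n)
arrangements-enumerates k n (arrangement π φ) =
  Any.concatMap⁺ _ (Any.map extend (permutations-enumerates n π))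
  where
  extend : ∀ {ρ} → π Perm.≈ ρ →
           Membership._∈_ (arrangementSetoid k n) (arrangement π φ) (map (arrangement ρ) (colourings k ρ))
  extend {ρ} e = Any.map⁺ (Any.map⁺ (Any.map
    (λ c → mk≈ e λ i p q → trans (cong (λ r → φ (i , r)) (≡-irrelevant _≟_ p _)) (c i q))
    (families-enumerates k (λ i → ρ ⟨$⟩ʳ i ≟ i) (λ _ → ≡-irrelevant _≟_)
      (λ i q → φ (i , trans (e i) q)))))

arrangements-unique : ∀ k n → Unique.Unique (arrangementSetoid k n) (arrangements k n)
arrangements-unique k n = Uniqueₚ.concat⁺ (arrangementSetoid k n)
  (All.map⁺ (All.universal block-unique (permutations n)))
  (AllPairs.map⁺ (AllPairs.map block-disjoint (permutations-unique n)))
  where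
  block : Permutation′ n → List (Arrangement k n)
  block π = map (arrangement π) (colourings k π)

  block-unique : ∀ π → Unique.Unique (arrangementSetoid k n) (block π)
  block-unique π = AllPairs.map⁺ (AllPairs.map⁺ (AllPairs.map
    (λ f≉g a≈b → f≉g λ i p → _≈_.colour≈ a≈b i p p)
    (families-unique k (λ i → π ⟨$⟩ʳ i ≟ i))))

  block-perm : ∀ {a} π → Membership._∈_ (arrangementSetoid k n) a (block π) → perm a Perm.≈ π
  block-perm π a∈ = _≈_.perm≈ (proj₂ (Any.satisfied (Any.map⁻ a∈)))

  block-disjoint : ∀ {π ρ} → ¬ π Perm.≈ ρ → Disjoint (arrangementSetoid k n) (block π) (block ρ)
  block-disjoint {π} {ρ} π≉ρ (a∈π , a∈ρ) =
    π≉ρ λ i → trans (sym (block-perm π a∈π i)) (block-perm ρ a∈ρ i)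

Matrix : ℕ → Set
Matrix n = Fin n → Fin n → ℕ

-- `ℕΠ.sum` is the fold over the multiplicative monoid, that is, the product.
permanent : Matrix n → ℕ
permanent {n} M = sum (map (λ π → ℕΠ.sum (λ i → M i (π ⟨$⟩ʳ i))) (permutations n))

diagonalOnes : ∀ k n → Matrix n
diagonalOnes k n i j = if does (i ≟ j) then k else 1

-- The sum runs over i ≤ n; the terms with i > n vanish.
binomialTransform : (ℕ → ℕ) → ℕ → ℕ
binomialTransform a n = ℕΣ.sum {suc n} (λ i → (n C toℕ i) ℕ.* a (toℕ i))

-- Formal power series over ℚ; `f n` is the coefficient of xⁿ.

Series : Set
Series = ℕ → ℚ

infixl 6 _⊖_
infixl 7 _⊛_ _⊘_

one : Series
one zero    = 1ℚ
one (suc _) = 0ℚ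

X : Series
X 1 = 1ℚ
X _ = 0ℚ

_⊖_ : Series → Series → Series
(f ⊖ g) n = f n ℚ.- g n

_⊛_ : Series → Series → Series
(f ⊛ g) n = ℚΣ.sum {suc n} (λ i → f (toℕ i) ℚ.* g (n ∸ toℕ i))

module _ (f : Series) .{{_ : ℚ.NonZero (f 0)}} where

  -- [ bₙ , … , b₀ ], where Σ bₙ xⁿ is the multiplicative inverse of f.
  inverseCoefficients : ∀ n → Vec ℚ (suc n)
  inverseCoefficients zero    = 1/ f 0 ∷ []
  inverseCoefficients (suc n) = ℚ.- (1/ f 0 ℚ.* ℚΣ.sum (λ i → f (suc (toℕ i)) ℚ.* Vec.lookup bs i)) ∷ bs
    where bs = inverseCoefficients n

  inverse : Series
  inverse n = Vec.head (inverseCoefficients n)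

  inverse-inverseʳ : f ⊛ inverse ≗ one
  inverse-inverseʳ zero    = trans (ℚ.+-identityʳ _) (ℚ.*-inverseʳ (f 0))
  inverse-inverseʳ (suc n) = begin
    f 0 ℚ.* ℚ.- (1/ f 0 ℚ.* s) ℚ.+ s′
      ≡⟨ cong₂ ℚ._+_ (sym (ℚ.neg-distribʳ-* (f 0) _))
               (ℚΣ.sum-cong-≗ λ i → cong (f (suc (toℕ i)) ℚ.*_) (sym (lookup-coefficients n i))) ⟩
    ℚ.- (f 0 ℚ.* (1/ f 0 ℚ.* s)) ℚ.+ s
      ≡⟨ cong (λ t → ℚ.- t ℚ.+ s) (trans (sym (ℚ.*-assoc (f 0) _ s)) (cong (ℚ._* s) (ℚ.*-inverseʳ (f 0)))) ⟩
    ℚ.- (1ℚ ℚ.* s) ℚ.+ s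
      ≡⟨ cong (λ t → ℚ.- t ℚ.+ s) (ℚ.*-identityˡ s) ⟩
    ℚ.- s ℚ.+ s
      ≡⟨ ℚ.+-inverseˡ s ⟩
    0ℚ ∎
    where
    open ≡-Reasoning
    s s′ : ℚ
    s  = ℚΣ.sum {suc n} (λ i → f (suc (toℕ i)) ℚ.* Vec.lookup (inverseCoefficients n) i)
    s′ = ℚΣ.sum {suc n} (λ i → f (suc (toℕ i)) ℚ.* inverse (n ∸ toℕ i))

    lookup-coefficients : ∀ n (i : Fin (suc n)) → Vec.lookup (inverseCoefficients n) i ≡ inverse (n ∸ toℕ i)
    lookup-coefficients zero    zero    = refl
    lookup-coefficients (suc n) zero    = refl
    lookup-coefficients (suc n) (suc i) = lookup-coefficients n i

_⊘_ : (f g : Series) .{{_ : ℚ.NonZero (g 0)}} → Series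
f ⊘ g = f ⊛ inverse g

-- The substitution f(c x).
scale : ℚ → Series → Series
scale c f n = c ℚ^.^ n ℚ.* f n

-- Σ aₙ xⁿ / n!
egf : (ℕ → ℕ) → Series
egf a n = (+ a n / n !) {{n ℕ.!≢0}}

exp : Series
exp = egf (const 1)

{-# OPTIONS --safe #-}

-- Counting colourings fixed point by fixed point gives the permanent formula. For a matrix with
-- diagonal x and 1s elsewhere, splitting off the point 0 from its cycle gives
--   F(x₀, x) = x₀ F(x) + Σⱼ F(x with xⱼ replaced by 1),
-- and F is symmetric because conjugation permutes the permutations. Let B(n) be F on n + 1 points
-- with one entry 1 and the others k. The expansion of the all-k diagonal and that of (1, k, …, k) read
--   A(n+2) = k A(n+1) + (n+1) B(n)   and   B(n) = A(n) + (A(n+1) − k A(n)),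
-- and eliminating B yields A(n+1) = (n+1) A(n) + (k−1)ⁿ⁺¹ by induction. The recurrence, divided by
-- (n+1)!, says that the coefficients of the generating function are partial sums of e^{(k−1)x}.
-- By i C(n,i) = n C(n−1,i−1) and the binomial theorem, the binomial transform turns the recurrence
-- for k into the one for k + 1.

module Submission where

open import Defs
open import Algebra using (CommutativeRing)
import Algebra.Properties.CommutativeSemiring.Binomial as BinomialTheorem
import Algebra.Properties.Semiring.Exp as SemiringExp
import Algebra.Properties.Semiring.Mult as SemiringMult
import Algebra.Properties.Semiring.Sum as SemiringSum
open import Data.Bool using (if_then_else_)
open import Data.Fin using (Fin; zero; suc; toℕ; inject₁; fromℕ)
open import Data.Fin.Permutation as Perm using (Permutation′; _⟨$⟩ʳ_; _∘ₚ_; flip; lift₀; remove; transpose)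
import Data.Fin.Permutation.Components as PC
open import Data.Fin.Properties using (_≟_; suc-injective; toℕ-inject₁; toℕ-fromℕ)
open import Data.Integer as ℤ using (ℤ; +_; 1ℤ)
import Data.Integer.Properties as ℤ
import Data.Integer.Tactic.RingSolver as ℤ
open import Data.List as List using (List; []; _∷_; _++_; map; concatMap; cartesianProductWith; allFin; length)
open import Data.List.Membership.Propositional.Properties using (∈-allFin)
import Data.List.Membership.Setoid as Membership
open import Data.List.Membership.Setoid.Properties as Mem using (∈-cartesianProductWith⁺; ∈-map⁺)
open import Data.List.Properties using (length-++; length-map; map-++; map-∘; map-cong; length-tabulate)
open import Data.List.Relation.Unary.All as All using ()
open import Data.List.Relation.Unary.AllPairs using ([]; _∷_)
open import Data.List.Relation.Unary.Any as Any using (here; there)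
import Data.List.Relation.Unary.Enumerates.Setoid as Enumerates
open import Data.List.Relation.Unary.Unique.Propositional.Properties using (allFin⁺)
import Data.List.Relation.Unary.Unique.Setoid as Unique
import Data.List.Relation.Unary.Unique.Setoid.Properties as Uniqueₚ
open import Data.Nat as ℕ using (ℕ; zero; suc; _+_; _*_; _∸_; _≤_; z≤n; _!)
open import Data.Nat.Combinatorics using (_C_; nCk+nC[k+1]≡[n+1]C[k+1]; nC1≡n)
open import Data.Nat.ListAction using (sum)
open import Data.Nat.ListAction.Properties using (sum-++)
import Data.Nat.Properties as ℕ
open import Data.Nat.Tactic.RingSolver using (solve-∀)
open import Data.Product using (_×_; _,_)
open import Data.Rational as ℚ using (ℚ; 0ℚ; 1ℚ; _/_; fromℚᵘ; toℚᵘ)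
import Data.Rational.Properties as ℚ
open import Data.Rational.Unnormalised as ℚᵘ using (mkℚᵘ; *≡*)
import Data.Rational.Unnormalised.Properties as ℚᵘ
open import Data.Vec as Vec using (_∷_)
open import Data.Vec.Functional using (Vector; head; tail; updateAt)
open import Data.Vec.Functional.Properties using (updateAt-updates; updateAt-minimal)
open import Function using (_∘_; const)
open import Function.Bundles using (Injection; mk⇔)
open import Function.Properties.Inverse using (↔⇒↣)
open import Relation.Binary using (Setoid; _Preserves_⟶_)
open import Relation.Binary.PropositionalEquality
open import Relation.Nullary using (Dec; does; yes; no; ¬_; contradiction)
open import Relation.Nullary.Decidable using (dec-true; does-⇔)

private
  module ℤΣ = SemiringSum ℤ.+-*-semiring
  module ℤ^ = SemiringExp ℤ.+-*-semiring
  module ℤ× = SemiringMult ℤ.+-*-semiring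
  module Binomial = BinomialTheorem (CommutativeRing.commutativeSemiring ℤ.+-*-commutativeRing)

  variable
    n : ℕ

-- Sums over lists and their independence of the enumeration.

module _ {a ℓ} (S : Setoid a ℓ) where
  open Setoid S using () renaming (Carrier to E; _≈_ to _≃_; sym to ≃-sym; trans to ≃-trans)
  open Membership S using (_∈_)

  private
    sum-─ : ∀ {φ : E → ℕ} → φ Preserves _≃_ ⟶ _≡_ → ∀ {x ys} (p : x ∈ ys) →
            sum (map φ ys) ≡ φ x + sum (map φ (ys Any.─ p))
    sum-─ {φ} resp {ys = y ∷ ys} (here x≃y) = cong (_+ sum (map φ ys)) (sym (resp x≃y))
    sum-─ {φ} resp {x} {y ∷ ys} (there p) = begin
      φ y + sum (map φ ys)                       ≡⟨ cong (φ y ℕ.+_) (sum-─ resp p) ⟩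
      φ y + (φ x + sum (map φ (ys Any.─ p)))     ≡⟨ swap₁₂ (φ y) (φ x) _ ⟩
      φ x + (φ y + sum (map φ (ys Any.─ p)))     ∎
      where
      open ≡-Reasoning
      swap₁₂ : ∀ a b c → a + (b + c) ≡ b + (a + c)
      swap₁₂ = solve-∀

    ∈-─ : ∀ {x z ys} (p : x ∈ ys) → ¬ x ≃ z → z ∈ ys → z ∈ (ys Any.─ p)
    ∈-─ (here x≃y) x≉z (here z≃y) = contradiction (≃-trans x≃y (≃-sym z≃y)) x≉z
    ∈-─ (here x≃y) x≉z (there q)  = q
    ∈-─ (there p)  x≉z (here z≃y) = here z≃y
    ∈-─ (there p)  x≉z (there q)  = there (∈-─ p x≉z q)

  -- Induction on `xs`: the head is matched with an equivalent entry of `ys`, which is then deleted.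
  -- By uniqueness no later entry of `xs` needs the deleted one.
  sum-⊆ : ∀ {φ : E → ℕ} → φ Preserves _≃_ ⟶ _≡_ → ∀ {xs ys} → Unique.Unique S xs →
          (∀ {z} → z ∈ xs → z ∈ ys) → sum (map φ xs) ≤ sum (map φ ys)
  sum-⊆ resp {[]}     []         xs⊆ys = z≤n
  sum-⊆ {φ} resp {x ∷ xs} {ys} (x∉xs ∷ xs!) xs⊆ys = begin
    φ x + sum (map φ xs)             ≤⟨ ℕ.+-monoʳ-≤ (φ x) (sum-⊆ resp xs! xs⊆ys─x) ⟩
    φ x + sum (map φ (ys Any.─ x∈ys)) ≡⟨ sum-─ resp x∈ys ⟨
    sum (map φ ys)                   ∎
    where
    open ℕ.≤-Reasoning
    x∈ys = xs⊆ys (here (Setoid.refl S))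
    xs⊆ys─x : ∀ {z} → z ∈ xs → z ∈ (ys Any.─ x∈ys)
    xs⊆ys─x z∈xs = ∈-─ x∈ys
      (λ x≃z → All.lookupWith (λ x≉w z≃w → x≉w (≃-trans x≃z z≃w)) x∉xs z∈xs)
      (xs⊆ys (there z∈xs))

  -- Two inequalities from mutual inclusion. This allows a sum over `permutations` to be computed
  -- from whichever enumeration suits: `extensions` for the expansion, conjugates for the symmetry.
  sum-enumeration : ∀ {φ : E → ℕ} → φ Preserves _≃_ ⟶ _≡_ → ∀ {xs ys} →
                    Unique.Unique S xs → Enumerates.IsEnumeration S xs →
                    Unique.Unique S ys → Enumerates.IsEnumeration S ys →
                    sum (map φ xs) ≡ sum (map φ ys)
  sum-enumeration resp xs! xs∋ ys! ys∋ =
    ℕ.≤-antisym (sum-⊆ resp xs! (λ _ → ys∋ _)) (sum-⊆ resp ys! (λ _ → xs∋ _))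

sum-map-tabulate : ∀ {A : Set} (φ : A → ℕ) {n} (g : Fin n → A) →
                   sum (map φ (List.tabulate g)) ≡ ℕΣ.sum (φ ∘ g)
sum-map-tabulate φ {zero}  g = refl
sum-map-tabulate φ {suc n} g = cong (φ (g zero) ℕ.+_) (sum-map-tabulate φ (g ∘ suc))

sum-cartesianProductWith : ∀ {A B C : Set} (φ : C → ℕ) (f : A → B → C) xs ys →
  sum (map φ (cartesianProductWith f xs ys)) ≡ sum (map (λ x → sum (map (φ ∘ f x) ys)) xs)
sum-cartesianProductWith φ f []       ys = refl
sum-cartesianProductWith φ f (x ∷ xs) ys = begin
  sum (map φ (map (f x) ys ++ rest))               ≡⟨ cong sum (map-++ φ (map (f x) ys) rest) ⟩
  sum (map φ (map (f x) ys) ++ map φ rest)         ≡⟨ sum-++ (map φ (map (f x) ys)) _ ⟩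
  sum (map φ (map (f x) ys)) + sum (map φ rest)    ≡⟨ cong₂ _+_ (cong sum (sym (map-∘ ys))) (sum-cartesianProductWith φ f xs ys) ⟩
  _ ∎
  where
  open ≡-Reasoning
  rest = cartesianProductWith f xs ys

sum-map-*ˡ : ∀ {A : Set} c (φ : A → ℕ) xs → sum (map (λ x → c * φ x) xs) ≡ c * sum (map φ xs)
sum-map-*ˡ c φ []       = sym (ℕ.*-zeroʳ c)
sum-map-*ˡ c φ (x ∷ xs) = trans (cong (c * φ x ℕ.+_) (sum-map-*ˡ c φ xs)) (sym (ℕ.*-distribˡ-+ c (φ x) _))

-- Expansion of the permanent along the point 0.

-- The test is oriented as `i ≟ π ⟨$⟩ʳ i` so that at `const k` this is definitionally the summand of
-- `permanent (diagonalOnes k n)`.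
weight : Vector ℕ n → Permutation′ n → ℕ
weight x π = ℕΠ.sum (λ i → if does (i ≟ π ⟨$⟩ʳ i) then x i else 1)

weight-resp-≈ : (x : Vector ℕ n) → weight x Preserves Perm._≈_ ⟶ _≡_
weight-resp-≈ x π≈ρ = ℕΠ.sum-cong-≗ λ i → cong (λ j → if does (i ≟ j) then x i else 1) (π≈ρ i)

-- F(x) above: the permanent of the matrix with diagonal x and 1s elsewhere.
diagonalPermanent : Vector ℕ n → ℕ
diagonalPermanent {n} x = sum (map (weight x) (permutations n))

-- Every permutation of Fin (suc n) is (0 j) ∘ lift₀ π in exactly one way; unlike `insert`,
-- this decomposition leaves the fixed points of π other than j in place.
extend : Fin (suc n) → Permutation′ n → Permutation′ (suc n)
extend j π = lift₀ π ∘ₚ transpose zero j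

extend-cong : ∀ {i j} {π ρ : Permutation′ n} → i ≡ j → π Perm.≈ ρ → extend i π Perm.≈ extend j ρ
extend-cong {j = j} {π} {ρ} refl π≈ρ i = cong (PC.transpose zero j) (Perm.lift₀-cong π ρ π≈ρ i)

-- The image of `zero` is the index of the transposition; undoing that transposition then recovers
-- the lifted permutation.
extend-injective : ∀ {i j} {π ρ : Permutation′ n} → extend i π Perm.≈ extend j ρ → i ≡ j × π Perm.≈ ρ
extend-injective {i = i} {π = π} {ρ} e with refl ← e zero = refl , λ l → suc-injective (begin
  suc (π ⟨$⟩ʳ l)                                           ≡⟨ PC.transpose-inverse i zero ⟨
  PC.transpose i zero (PC.transpose zero i (suc (π ⟨$⟩ʳ l))) ≡⟨ cong (PC.transpose i zero) (e (suc l)) ⟩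
  PC.transpose i zero (PC.transpose zero i (suc (ρ ⟨$⟩ʳ l))) ≡⟨ PC.transpose-inverse i zero ⟩
  suc (ρ ⟨$⟩ʳ l)                                           ∎)
  where open ≡-Reasoning

transpose-matchˡ : ∀ (i j : Fin n) → PC.transpose i j i ≡ j
transpose-matchˡ i j rewrite dec-true (i ≟ i) refl = refl

extensions : ∀ n → List (Permutation′ (suc n))
extensions n = cartesianProductWith extend (allFin (suc n)) (permutations n)

extensions-enumerates : ∀ n → Enumerates.IsEnumeration (permutationSetoid (suc n)) (extensions n)
extensions-enumerates n σ =
  Mem.∈-resp-≈ (permutationSetoid (suc n)) {x = extend j (remove zero τ)} {y = σ} extend≈σ
    (∈-cartesianProductWith⁺ (setoid _) (permutationSetoid n) (permutationSetoid (suc n))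
      (λ {i} {j} {π} {ρ} → extend-cong {π = π} {ρ})
      (∈-allFin j) (permutations-enumerates n (remove zero τ)))
  where
  j = σ ⟨$⟩ʳ zero
  -- The transposition brings the image of `zero` back to `zero`, so `τ` fixes `zero` and is the
  -- lift of its removal.
  τ = σ ∘ₚ transpose j zero
  extend≈σ : extend j (remove zero τ) Perm.≈ σ
  extend≈σ i = trans (cong (PC.transpose zero j) (Perm.lift₀-remove τ (transpose-matchˡ j zero) i))
    (PC.transpose-inverse zero j)

extensions-unique : ∀ n → Unique.Unique (permutationSetoid (suc n)) (extensions n)
extensions-unique n =
  Uniqueₚ.cartesianProductWith⁺ (setoid _) (permutationSetoid n) (permutationSetoid (suc n))
    extend (λ {i} {j} {π} {ρ} → extend-injective {π = π} {ρ}) (allFin⁺ (suc n)) (permutations-unique n)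

infixl 8 _[_]≔1
_[_]≔1 : Vector ℕ n → Fin n → Vector ℕ n
x [ j ]≔1 = updateAt x j (const 1)

-- The point 0 moves and contributes 1. The only fixed point of `π` that can be lost is `j`, since
-- its image is redirected to 0; replacing its entry by 1 accounts for that.
weight-extend-suc : ∀ (x : Vector ℕ (suc n)) j π → weight x (extend (suc j) π) ≡ weight (tail x [ j ]≔1) π
weight-extend-suc x j π = trans (ℕ.*-identityˡ _) (ℕΠ.sum-cong-≗ factor)
  where
  factor : ∀ i → (if does (suc i ≟ PC.transpose zero (suc j) (suc (π ⟨$⟩ʳ i))) then x (suc i) else 1)
               ≡ (if does (i ≟ π ⟨$⟩ʳ i) then (tail x [ j ]≔1) i else 1)
  factor i with π ⟨$⟩ʳ i ≟ j
  ... | no πi≢j with i ≟ π ⟨$⟩ʳ i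
  ...   | yes i≡πi = sym (updateAt-minimal i j (tail x) (πi≢j ∘ trans (sym i≡πi)))
  ...   | no _     = refl
  -- Here `suc i` is sent to `zero`, so the left factor is 1 whether or not `π` fixes `i`.
  factor i | yes πi≡j with i ≟ π ⟨$⟩ʳ i
  ...   | yes i≡πi rewrite trans i≡πi πi≡j = sym (updateAt-updates j (tail x))
  ...   | no _     = refl

diagonalPermanent-expand : ∀ (x : Vector ℕ (suc n)) →
  diagonalPermanent x ≡ head x * diagonalPermanent (tail x) + ℕΣ.sum (λ j → diagonalPermanent (tail x [ j ]≔1))
diagonalPermanent-expand {n} x = begin
  diagonalPermanent x
    ≡⟨ sum-enumeration (permutationSetoid (suc n)) (λ {π} {ρ} → weight-resp-≈ x {π} {ρ})
         (permutations-unique (suc n)) (permutations-enumerates (suc n)) (extensions-unique n) (extensions-enumerates n) ⟩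
  sum (map (weight x) (extensions n))
    ≡⟨ sum-cartesianProductWith (weight x) extend (allFin (suc n)) (permutations n) ⟩
  sum (map (λ j → sum (map (weight x ∘ extend j) (permutations n))) (allFin (suc n)))
    ≡⟨ sum-map-tabulate (λ j → sum (map (weight x ∘ extend j) (permutations n))) {suc n} (λ j → j) ⟩
  ℕΣ.sum (λ j → sum (map (weight x ∘ extend j) (permutations n)))
    -- For the index `zero` the transposition is trivial, and each summand computes to `head x`
    -- times the weight of `π`.
    ≡⟨ cong₂ _+_ (sum-map-*ˡ (head x) (weight (tail x)) (permutations n))
         (ℕΣ.sum-cong-≗ λ j → cong sum (map-cong (weight-extend-suc x j) (permutations n))) ⟩
  _ ∎
  where open ≡-Reasoning

-- Symmetry of the permanent under conjugation.

conjugate : Permutation′ n → Permutation′ n → Permutation′ n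
conjugate τ π = flip τ ∘ₚ (π ∘ₚ τ)

-- The product is reindexed along `τ`: the conjugate fixes `τ ⟨$⟩ʳ i` exactly when `π` fixes `i`.
weight-conjugate : ∀ (x : Vector ℕ n) τ π → weight x (conjugate τ π) ≡ weight (x ∘ (τ ⟨$⟩ʳ_)) π
weight-conjugate x τ π = trans (ℕΠ.sum-permute _ τ) (ℕΠ.sum-cong-≗ λ i →
  cong (λ b → if b then x (τ ⟨$⟩ʳ i) else 1)
    (does-⇔ (mk⇔ (λ e → τ-injective (trans e (cong (λ l → τ ⟨$⟩ʳ (π ⟨$⟩ʳ l)) (Perm.inverseˡ τ))))
                 (λ e → trans (cong (τ ⟨$⟩ʳ_) e) (cong (λ l → τ ⟨$⟩ʳ (π ⟨$⟩ʳ l)) (sym (Perm.inverseˡ τ)))))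
      (τ ⟨$⟩ʳ i ≟ conjugate τ π ⟨$⟩ʳ (τ ⟨$⟩ʳ i)) (i ≟ π ⟨$⟩ʳ i)))
  where τ-injective = Injection.injective (↔⇒↣ τ)

-- Conjugation by `τ` is a bijection with inverse conjugation by `flip τ`, so the conjugates again
-- enumerate all permutations.
diagonalPermanent-permute : ∀ (x : Vector ℕ n) τ → diagonalPermanent (x ∘ (τ ⟨$⟩ʳ_)) ≡ diagonalPermanent x
diagonalPermanent-permute {n} x τ = begin
  sum (map (weight (x ∘ (τ ⟨$⟩ʳ_))) (permutations n))
    ≡⟨ cong sum (map-cong (weight-conjugate x τ) (permutations n)) ⟨
  sum (map (weight x ∘ conjugate τ) (permutations n))
    ≡⟨ cong sum (map-∘ (permutations n)) ⟩
  sum (map (weight x) (map (conjugate τ) (permutations n)))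
    ≡⟨ sum-enumeration (permutationSetoid n) (λ {π} {ρ} → weight-resp-≈ x {π} {ρ})
         conjugates-unique conjugates-enumerate (permutations-unique n) (permutations-enumerates n) ⟩
  sum (map (weight x) (permutations n)) ∎
  where
  open ≡-Reasoning
  conjugate-cong : ∀ τ {π ρ : Permutation′ n} → π Perm.≈ ρ → conjugate τ π Perm.≈ conjugate τ ρ
  conjugate-cong τ π≈ρ i = cong (τ ⟨$⟩ʳ_) (π≈ρ _)

  conjugate-flip : ∀ τ π → conjugate τ (conjugate (flip τ) π) Perm.≈ π
  conjugate-flip τ π i = trans (Perm.inverseʳ τ) (cong (π ⟨$⟩ʳ_) (Perm.inverseʳ τ))

  conjugates-unique : Unique.Unique (permutationSetoid n) (map (conjugate τ) (permutations n))
  conjugates-unique = Uniqueₚ.map⁺ (permutationSetoid n) (permutationSetoid n)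
    (λ {π} {ρ} e i → trans (sym (conjugate-flip (flip τ) π i))
      (trans (conjugate-cong (flip τ) {conjugate τ π} {conjugate τ ρ} e i) (conjugate-flip (flip τ) ρ i)))
    (permutations-unique n)

  conjugates-enumerate : Enumerates.IsEnumeration (permutationSetoid n) (map (conjugate τ) (permutations n))
  conjugates-enumerate π = Mem.∈-resp-≈ (permutationSetoid n)
    {x = conjugate τ (conjugate (flip τ) π)} {y = π} (conjugate-flip τ π)
    (∈-map⁺ (permutationSetoid n) (permutationSetoid n) {f = conjugate τ}
      (λ {π} {ρ} → conjugate-cong τ {π} {ρ}) {v = conjugate (flip τ) π}
      (permutations-enumerates n (conjugate (flip τ) π)))

diagonalPermanent-cong : {x y : Vector ℕ n} → x ≗ y → diagonalPermanent x ≡ diagonalPermanent y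
diagonalPermanent-cong {n} x≗y = cong sum (map-cong
  (λ π → ℕΠ.sum-cong-≗ λ i → cong (λ v → if does (i ≟ π ⟨$⟩ʳ i) then v else 1) (x≗y i)) (permutations n))

-- Counting colourings: the permanent formula.

length-concatMap : ∀ {A B : Set} (f : A → List B) xs → length (concatMap f xs) ≡ sum (map (length ∘ f) xs)
length-concatMap f []       = refl
length-concatMap f (x ∷ xs) = trans (length-++ (f x)) (cong (length (f x) ℕ.+_) (length-concatMap f xs))

length-cartesianProductWith : ∀ {A B C : Set} (f : A → B → C) xs ys →
                              length (cartesianProductWith f xs ys) ≡ length xs * length ys
length-cartesianProductWith f []       ys = refl
length-cartesianProductWith f (x ∷ xs) ys =
  trans (length-++ (map (f x) ys)) (cong₂ _+_ (length-map (f x) ys) (length-cartesianProductWith f xs ys))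

length-maps : ∀ k {P : Set} (P? : Dec P) → length (maps k P?) ≡ (if does P? then k else 1)
length-maps k (yes _) = trans (length-map _ (allFin k)) (length-tabulate {n = k} _)
length-maps k (no _)  = refl

length-families : ∀ k {n} {P : Fin n → Set} (P? : ∀ i → Dec (P i)) →
                  length (families k P?) ≡ ℕΠ.sum (λ i → if does (P? i) then k else 1)
length-families k {zero}  P? = refl
length-families k {suc n} {P} P? = trans (length-cartesianProductWith (cons k {P = P}) (maps k (P? zero)) (families k (P? ∘ suc)))
  (cong₂ _*_ (length-maps k (P? zero)) (length-families k (P? ∘ suc)))

-- For a given permutation, each fixed point has `k` independent choices of colour and every other
-- point only the empty map.
A≡permanent : ∀ k n → A k n ≡ permanent (diagonalOnes k n)
A≡permanent k n = trans (length-concatMap _ (permutations n)) (cong sum (map-cong length-block (permutations n)))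
  where
  open ≡-Reasoning
  length-block : ∀ π → length (map (arrangement π) (colourings k π)) ≡ weight (const k) π
  length-block π = begin
    length (map (arrangement π) (colourings k π))    ≡⟨ length-map (arrangement π) (colourings k π) ⟩
    length (colourings k π)                          ≡⟨ length-map _ (families k λ i → π ⟨$⟩ʳ i ≟ i) ⟩
    length (families k λ i → π ⟨$⟩ʳ i ≟ i)           ≡⟨ length-families k (λ i → π ⟨$⟩ʳ i ≟ i) ⟩
    ℕΠ.sum (λ i → if does (π ⟨$⟩ʳ i ≟ i) then k else 1)
      ≡⟨ ℕΠ.sum-cong-≗ (λ i → cong (λ b → if b then k else 1) (does-⇔ (mk⇔ sym sym) (π ⟨$⟩ʳ i ≟ i) (i ≟ π ⟨$⟩ʳ i))) ⟩
    weight (const k) π ∎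

-- The recurrence.

sum-const : ∀ n c → ℕΣ.sum {n} (const c) ≡ n * c
sum-const zero    c = refl
sum-const (suc n) c = cong (c ℕ.+_) (sum-const n c)

const-[]≔1-permute : ∀ k (τ : Permutation′ n) j → (const k [ τ ⟨$⟩ʳ j ]≔1) ∘ (τ ⟨$⟩ʳ_) ≗ const k [ j ]≔1
const-[]≔1-permute k τ j i with i ≟ j
... | yes refl = trans (updateAt-updates (τ ⟨$⟩ʳ j) (const k)) (sym (updateAt-updates j (const k)))
... | no i≢j   = trans (updateAt-minimal (τ ⟨$⟩ʳ i) (τ ⟨$⟩ʳ j) (const k) (i≢j ∘ Injection.injective (↔⇒↣ τ)))
                       (sym (updateAt-minimal i j (const k) i≢j))

-- Counts the k-arrangements of n + 1 points in which the point 0, if fixed, has a single colour available.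
B : ℕ → ℕ → ℕ
B k n = diagonalPermanent {suc n} (const k [ zero ]≔1)

-- By symmetry the transposition of `j` and `zero` may move the exceptional entry to the front.
diagonalPermanent-[]≔1 : ∀ k n (j : Fin (suc n)) → diagonalPermanent (const k [ j ]≔1) ≡ B k n
diagonalPermanent-[]≔1 k n j = begin
  diagonalPermanent (const k [ j ]≔1)
    ≡⟨ diagonalPermanent-cong (const-[]≔1-permute k τ j) ⟨
  diagonalPermanent ((const k [ τ ⟨$⟩ʳ j ]≔1) ∘ (τ ⟨$⟩ʳ_))
    ≡⟨ diagonalPermanent-permute (const k [ τ ⟨$⟩ʳ j ]≔1) τ ⟩
  diagonalPermanent (const k [ τ ⟨$⟩ʳ j ]≔1)
    ≡⟨ cong (λ l → diagonalPermanent (const k [ l ]≔1)) (transpose-matchˡ j zero) ⟩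
  B k n ∎
  where
  open ≡-Reasoning
  τ = transpose j zero

A-expand : ∀ k n → A k (suc n) ≡ k * A k n + ℕΣ.sum (λ j → diagonalPermanent {n} (const k [ j ]≔1))
A-expand k n = begin
  A k (suc n)                        ≡⟨ A≡permanent k (suc n) ⟩
  diagonalPermanent {suc n} (const k) ≡⟨ diagonalPermanent-expand {n} (const k) ⟩
  k * diagonalPermanent {n} (const k) + s ≡⟨ cong (λ a → k * a + s) (A≡permanent k n) ⟨
  k * A k n + s ∎
  where
  open ≡-Reasoning
  s = ℕΣ.sum (λ j → diagonalPermanent {n} (const k [ j ]≔1))

A-suc-suc : ∀ k n → A k (suc (suc n)) ≡ k * A k (suc n) + suc n * B k n
A-suc-suc k n = trans (A-expand k (suc n)) (cong (k * A k (suc n) ℕ.+_)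
  (trans (ℕΣ.sum-cong-≗ (diagonalPermanent-[]≔1 k n)) (sum-const (suc n) (B k n))))

-- The diagonals `const k` and `const k [ zero ]≔1` have the same tail, so their expansions share
-- the sum `s` and differ only in the coefficient of `A k n`, which is `k` or 1. Adding terms on
-- both sides avoids subtraction in ℕ.
A-suc+A : ∀ k n → A k (suc n) + A k n ≡ k * A k n + B k n
A-suc+A k n = begin
  A k (suc n) + A k n          ≡⟨ cong (_+ A k n) (A-expand k n) ⟩
  k * A k n + s + A k n        ≡⟨ shuffle (k * A k n) s (A k n) ⟩
  k * A k n + (1 * A k n + s)  ≡⟨ cong (λ a → k * A k n + (1 * a + s)) (A≡permanent k n) ⟩
  k * A k n + (1 * diagonalPermanent {n} (const k) + s)
    ≡⟨ cong (k * A k n ℕ.+_) (diagonalPermanent-expand {n} (const k [ zero ]≔1)) ⟨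
  k * A k n + B k n            ∎
  where
  open ≡-Reasoning
  s = ℕΣ.sum (λ j → diagonalPermanent {n} (const k [ j ]≔1))
  shuffle : ∀ a b c → a + b + c ≡ a + (1 * c + b)
  shuffle = solve-∀

-- Integer-valued because it is -1 at `k = 0`, the case of derangements.
predℤ : ℕ → ℤ
predℤ k = + k ℤ.- 1ℤ

A-recurrence : ∀ k n → + A k (suc n) ≡ + suc n ℤ.* + A k n ℤ.+ predℤ k ℤ.^ suc n
A-recurrence k zero = begin
  + A k 1                ≡⟨ cong +_ (A-expand k 0) ⟩
  + (k * 1 + 0)          ≡⟨ cong +_ (trans (ℕ.+-identityʳ _) (ℕ.*-identityʳ k)) ⟩
  + k                    ≡⟨ lemma (+ k) ⟩
  1ℤ ℤ.* 1ℤ ℤ.+ predℤ k ℤ.* 1ℤ ∎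
  where
  open ≡-Reasoning
  lemma : ∀ x → x ≡ 1ℤ ℤ.* 1ℤ ℤ.+ (x ℤ.- 1ℤ) ℤ.* 1ℤ
  lemma = ℤ.solve-∀
A-recurrence k (suc n) = begin
  + A k (suc (suc n))
    ≡⟨ cong +_ (A-suc-suc k n) ⟩
  + (k * a′ + suc n * b)
    ≡⟨ cong₂ ℤ._+_ (ℤ.pos-* k a′) (ℤ.pos-* (suc n) b) ⟩
  + k ℤ.* + a′ ℤ.+ + suc n ℤ.* + b
    ≡⟨ eliminate (+ k) (+ suc n) (+ a) (+ a′) (+ b) (predℤ k ℤ.^ suc n) (A-recurrence k n)
         (trans (cong +_ (A-suc+A k n)) (cong (ℤ._+ + b) (ℤ.pos-* k a))) ⟩
  (1ℤ ℤ.+ + suc n) ℤ.* + a′ ℤ.+ predℤ k ℤ.^ suc (suc n) ∎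
  where
  open ≡-Reasoning
  a  = A k n
  a′ = A k (suc n)
  -- The auxiliary count to be eliminated between `A-suc-suc` and `A-suc+A`.
  b  = B k n
  -- The hypotheses determine `b = a′ + a − k a` and `c = a′ − m a`; after substitution the claim is
  -- the polynomial identity `id₂`.
  eliminate : ∀ k m a a′ b c → a′ ≡ m ℤ.* a ℤ.+ c → a′ ℤ.+ a ≡ k ℤ.* a ℤ.+ b →
              k ℤ.* a′ ℤ.+ m ℤ.* b ≡ (1ℤ ℤ.+ m) ℤ.* a′ ℤ.+ (k ℤ.- 1ℤ) ℤ.* c
  eliminate k m a a′ b c p q = begin
    k ℤ.* a′ ℤ.+ m ℤ.* b
      ≡⟨ cong (λ t → k ℤ.* a′ ℤ.+ m ℤ.* t) (trans (id₁ k a b) (cong (ℤ._- k ℤ.* a) (sym q))) ⟩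
    k ℤ.* a′ ℤ.+ m ℤ.* (a′ ℤ.+ a ℤ.- k ℤ.* a)
      ≡⟨ id₂ k m a a′ ⟩
    (1ℤ ℤ.+ m) ℤ.* a′ ℤ.+ (k ℤ.- 1ℤ) ℤ.* (a′ ℤ.- m ℤ.* a)
      ≡⟨ cong (λ t → (1ℤ ℤ.+ m) ℤ.* a′ ℤ.+ (k ℤ.- 1ℤ) ℤ.* t) (trans (cong (ℤ._- m ℤ.* a) p) (id₃ m a c)) ⟩
    (1ℤ ℤ.+ m) ℤ.* a′ ℤ.+ (k ℤ.- 1ℤ) ℤ.* c ∎
    where
    id₁ : ∀ k a b → b ≡ k ℤ.* a ℤ.+ b ℤ.- k ℤ.* a
    id₁ = ℤ.solve-∀
    id₂ : ∀ k m a a′ → k ℤ.* a′ ℤ.+ m ℤ.* (a′ ℤ.+ a ℤ.- k ℤ.* a) ≡ (1ℤ ℤ.+ m) ℤ.* a′ ℤ.+ (k ℤ.- 1ℤ) ℤ.* (a′ ℤ.- m ℤ.* a)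
    id₂ = ℤ.solve-∀
    id₃ : ∀ m a c → m ℤ.* a ℤ.+ c ℤ.- m ℤ.* a ≡ c
    id₃ = ℤ.solve-∀

-- The binomial transform.

-- Absorption, by induction with Pascal's rule: one copy of `x` is set aside so that the remaining
-- coefficients fit the two induction hypotheses, and Pascal's rule one row lower reassembles `x`.
[k+1]*[n+1]C[k+1]≡[n+1]*nCk : ∀ n k → suc k * (suc n C suc k) ≡ suc n * (n C k)
[k+1]*[n+1]C[k+1]≡[n+1]*nCk n zero = trans (ℕ.*-identityˡ _) (trans (nC1≡n (suc n)) (sym (ℕ.*-identityʳ (suc n))))
[k+1]*[n+1]C[k+1]≡[n+1]*nCk zero (suc k) = ℕ.*-zeroʳ (suc (suc k))
[k+1]*[n+1]C[k+1]≡[n+1]*nCk (suc n) (suc k) = begin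
  (2 + k) * (suc (suc n) C suc (suc k))
    ≡⟨ cong ((2 + k) *_) (nCk+nC[k+1]≡[n+1]C[k+1] (suc n) (suc k)) ⟨
  (2 + k) * (x + y)
    ≡⟨ split k x y ⟩
  x + (suc k * x + (2 + k) * y)
    ≡⟨ cong₂ (λ s t → x + (s + t)) ([k+1]*[n+1]C[k+1]≡[n+1]*nCk n k) ([k+1]*[n+1]C[k+1]≡[n+1]*nCk n (suc k)) ⟩
  x + (suc n * (n C k) + suc n * (n C suc k))
    ≡⟨ cong (x ℕ.+_) (ℕ.*-distribˡ-+ (suc n) (n C k) (n C suc k)) ⟨
  x + suc n * (n C k + n C suc k)
    ≡⟨ cong (λ t → x + suc n * t) (nCk+nC[k+1]≡[n+1]C[k+1] n k) ⟩
  (2 + n) * x ∎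
  where
  open ≡-Reasoning
  x = suc n C suc k
  y = suc n C suc (suc k)
  split : ∀ k x y → (2 + k) * (x + y) ≡ x + ((1 + k) * x + (2 + k) * y)
  split = solve-∀

×≡* : ∀ n x → n ℤ×.× x ≡ + n ℤ.* x
×≡* zero    x = sym (ℤ.*-zeroˡ x)
×≡* (suc n) x = trans (cong (ℤ._+_ x) (×≡* n x)) (sym (ℤ.suc-* (+ n) x))

^≡^ : ∀ x n → x ℤ^.^ n ≡ x ℤ.^ n
^≡^ x zero    = refl
^≡^ x (suc n) = cong (x ℤ.*_) (^≡^ x n)

[x+1]^n : ∀ x n → (x ℤ.+ 1ℤ) ℤ.^ n ≡ ℤΣ.sum {suc n} (λ i → + (n C toℕ i) ℤ.* x ℤ.^ toℕ i)
[x+1]^n x n = begin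
  (x ℤ.+ 1ℤ) ℤ.^ n               ≡⟨ ^≡^ (x ℤ.+ 1ℤ) n ⟨
  (x ℤ.+ 1ℤ) ℤ^.^ n              ≡⟨ Binomial.theorem n x 1ℤ ⟩
  Binomial.binomialExpansion x 1ℤ n ≡⟨ ℤΣ.sum-cong-≗ {suc n} (λ i →
    trans (×≡* (n C toℕ i) _) (cong (+ (n C toℕ i) ℤ.*_) (term (toℕ i) (n ∸ toℕ i)))) ⟩
  ℤΣ.sum {suc n} (λ i → + (n C toℕ i) ℤ.* x ℤ.^ toℕ i) ∎
  where
  open ≡-Reasoning
  term : ∀ i j → x ℤ^.^ i ℤ.* 1ℤ ℤ^.^ j ≡ x ℤ.^ i
  term i j = trans (cong₂ ℤ._*_ (^≡^ x i) (trans (^≡^ 1ℤ j) (ℤ.^-zeroˡ j))) (ℤ.*-identityʳ (x ℤ.^ i))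

pos-sum : ∀ {n} (f : Fin n → ℕ) → + ℕΣ.sum f ≡ ℤΣ.sum (+_ ∘ f)
pos-sum {zero}  f = refl
pos-sum {suc n} f = cong (ℤ._+_ (+ f zero)) (pos-sum (f ∘ suc))

-- The recurrence for `a` splits each term with positive index. By absorption the first parts form
-- `suc n` times the transform at `n`; the powers of `c` make up a binomial expansion.
binomialTransform-recurrence : ∀ (a : ℕ → ℕ) c → a 0 ≡ 1 →
  (∀ n → + a (suc n) ≡ + suc n ℤ.* + a n ℤ.+ c ℤ.^ suc n) → ∀ n →
  + binomialTransform a (suc n) ≡ + suc n ℤ.* + binomialTransform a n ℤ.+ (c ℤ.+ 1ℤ) ℤ.^ suc n
binomialTransform-recurrence a c a₀≡1 a-rec n = begin
  + binomialTransform a (suc n)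
    ≡⟨ pos-sum {suc (suc n)} (λ i → (suc n C toℕ i) * a (toℕ i)) ⟩
  + (1 * a 0) ℤ.+ ℤΣ.sum {suc n} (λ i → + ((suc n C suc (toℕ i)) * a (suc (toℕ i))))
    ≡⟨ cong₂ ℤ._+_ (cong (λ t → + (1 * t)) a₀≡1) (ℤΣ.sum-cong-≗ {suc n} (term ∘ toℕ)) ⟩
  1ℤ ℤ.+ ℤΣ.sum {suc n} (λ i → f (toℕ i) ℤ.+ g (toℕ i))
    ≡⟨ cong (ℤ._+_ 1ℤ) (ℤΣ.∑-distrib-+ {suc n} (f ∘ toℕ) (g ∘ toℕ)) ⟩
  1ℤ ℤ.+ (ℤΣ.sum {suc n} (f ∘ toℕ) ℤ.+ ℤΣ.sum {suc n} (g ∘ toℕ))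
    -- The 1 coming from `a 0` serves as the constant term of the expansion of `(c + 1)` to the
    -- power `suc n`.
    ≡⟨ exchange 1ℤ (ℤΣ.sum {suc n} (f ∘ toℕ)) (ℤΣ.sum {suc n} (g ∘ toℕ)) ⟩
  ℤΣ.sum {suc n} (f ∘ toℕ) ℤ.+ (1ℤ ℤ.+ ℤΣ.sum {suc n} (g ∘ toℕ))
    ≡⟨ cong₂ ℤ._+_ (ℤΣ.*-distribˡ-sum {suc n} (+ suc n) (λ i → + ((n C toℕ i) * a (toℕ i)))) ([x+1]^n c (suc n)) ⟨
  + suc n ℤ.* ℤΣ.sum {suc n} (λ i → + ((n C toℕ i) * a (toℕ i))) ℤ.+ (c ℤ.+ 1ℤ) ℤ.^ suc n
    ≡⟨ cong (λ t → + suc n ℤ.* t ℤ.+ (c ℤ.+ 1ℤ) ℤ.^ suc n) (pos-sum {suc n} (λ i → (n C toℕ i) * a (toℕ i))) ⟨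
  + suc n ℤ.* + binomialTransform a n ℤ.+ (c ℤ.+ 1ℤ) ℤ.^ suc n ∎
  where
  open ≡-Reasoning
  f g : ℕ → ℤ
  f i = + suc n ℤ.* + ((n C i) * a i)
  g i = + (suc n C suc i) ℤ.* c ℤ.^ suc i
  exchange : ∀ x y z → x ℤ.+ (y ℤ.+ z) ≡ y ℤ.+ (x ℤ.+ z)
  exchange = ℤ.solve-∀
  term : ∀ i → + ((suc n C suc i) * a (suc i)) ≡ f i ℤ.+ g i
  term i = begin
    + (q * a (suc i))                              ≡⟨ ℤ.pos-* q (a (suc i)) ⟩
    + q ℤ.* + a (suc i)                            ≡⟨ cong (+ q ℤ.*_) (a-rec i) ⟩
    + q ℤ.* (+ suc i ℤ.* + a i ℤ.+ c ℤ.^ suc i)    ≡⟨ distrib (+ q) (+ suc i) (+ a i) (c ℤ.^ suc i) ⟩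
    + suc i ℤ.* + q ℤ.* + a i ℤ.+ g i              ≡⟨ cong (λ t → t ℤ.* + a i ℤ.+ g i) (ℤ.pos-* (suc i) q) ⟨
    + (suc i * q) ℤ.* + a i ℤ.+ g i                ≡⟨ cong (λ t → + t ℤ.* + a i ℤ.+ g i) ([k+1]*[n+1]C[k+1]≡[n+1]*nCk n i) ⟩
    + (suc n * (n C i)) ℤ.* + a i ℤ.+ g i          ≡⟨ cong (ℤ._+ g i) (ℤ.pos-* (suc n * (n C i)) (a i)) ⟨
    + (suc n * (n C i) * a i) ℤ.+ g i              ≡⟨ cong (λ t → + t ℤ.+ g i) (ℕ.*-assoc (suc n) (n C i) (a i)) ⟩
    + (suc n * ((n C i) * a i)) ℤ.+ g i            ≡⟨ cong (ℤ._+ g i) (ℤ.pos-* (suc n) ((n C i) * a i)) ⟩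
    f i ℤ.+ g i                                    ∎
    where
    q = suc n C suc i
    distrib : ∀ q m x y → q ℤ.* (m ℤ.* x ℤ.+ y) ≡ m ℤ.* q ℤ.* x ℤ.+ q ℤ.* y
    distrib = ℤ.solve-∀

-- Both sequences start at 1 and obey the same recurrence, since `predℤ (suc k)` equals `predℤ k`
-- plus 1.
A-binomialTransform : ∀ k → A (suc k) ≗ binomialTransform (A k)
A-binomialTransform k zero    = refl
A-binomialTransform k (suc n) = ℤ.+-injective (begin
  + A (suc k) (suc n)
    ≡⟨ A-recurrence (suc k) n ⟩
  + suc n ℤ.* + A (suc k) n ℤ.+ predℤ (suc k) ℤ.^ suc n
    ≡⟨ cong₂ (λ a c → + suc n ℤ.* + a ℤ.+ c ℤ.^ suc n) (A-binomialTransform k n) (lemma (+ k)) ⟩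
  + suc n ℤ.* + binomialTransform (A k) n ℤ.+ (predℤ k ℤ.+ 1ℤ) ℤ.^ suc n
    ≡⟨ binomialTransform-recurrence (A k) (predℤ k) refl (A-recurrence k) n ⟨
  + binomialTransform (A k) (suc n) ∎)
  where
  open ≡-Reasoning
  lemma : ∀ x → (1ℤ ℤ.+ x) ℤ.- 1ℤ ≡ x ℤ.- 1ℤ ℤ.+ 1ℤ
  lemma = ℤ.solve-∀

-- Arithmetic of fractions.

-- Passing to unnormalised fractions reduces the rules for `_/_` below to cross-multiplication in ℤ.
fromℚᵘ-homo-+ : ∀ p q → fromℚᵘ (p ℚᵘ.+ q) ≡ fromℚᵘ p ℚ.+ fromℚᵘ q
fromℚᵘ-homo-+ p q = ℚ.toℚᵘ-injective (begin
  toℚᵘ (fromℚᵘ (p ℚᵘ.+ q))                 ≈⟨ ℚ.toℚᵘ-fromℚᵘ (p ℚᵘ.+ q) ⟩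
  p ℚᵘ.+ q                                 ≈⟨ ℚᵘ.+-cong (ℚ.toℚᵘ-fromℚᵘ p) (ℚ.toℚᵘ-fromℚᵘ q) ⟨
  toℚᵘ (fromℚᵘ p) ℚᵘ.+ toℚᵘ (fromℚᵘ q)     ≈⟨ ℚ.toℚᵘ-homo-+ (fromℚᵘ p) (fromℚᵘ q) ⟨
  toℚᵘ (fromℚᵘ p ℚ.+ fromℚᵘ q)             ∎)
  where open ℚᵘ.≃-Reasoning

fromℚᵘ-homo-* : ∀ p q → fromℚᵘ (p ℚᵘ.* q) ≡ fromℚᵘ p ℚ.* fromℚᵘ q
fromℚᵘ-homo-* p q = ℚ.toℚᵘ-injective (begin
  toℚᵘ (fromℚᵘ (p ℚᵘ.* q))                 ≈⟨ ℚ.toℚᵘ-fromℚᵘ (p ℚᵘ.* q) ⟩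
  p ℚᵘ.* q                                 ≈⟨ ℚᵘ.*-cong (ℚ.toℚᵘ-fromℚᵘ p) (ℚ.toℚᵘ-fromℚᵘ q) ⟨
  toℚᵘ (fromℚᵘ p) ℚᵘ.* toℚᵘ (fromℚᵘ q)     ≈⟨ ℚ.toℚᵘ-homo-* (fromℚᵘ p) (fromℚᵘ q) ⟨
  toℚᵘ (fromℚᵘ p ℚ.* fromℚᵘ q)             ∎)
  where open ℚᵘ.≃-Reasoning

/-distribʳ-+ : ∀ i j d .{{_ : ℕ.NonZero d}} → (i ℤ.+ j) / d ≡ i / d ℚ.+ j / d
/-distribʳ-+ i j d@(suc d-1) = trans
  (ℚ.fromℚᵘ-cong {mkℚᵘ (i ℤ.+ j) d-1} {mkℚᵘ i d-1 ℚᵘ.+ mkℚᵘ j d-1} (*≡* (lemma i j (+ d))))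
  (fromℚᵘ-homo-+ (mkℚᵘ i d-1) (mkℚᵘ j d-1))
  where
  lemma : ∀ i j d → (i ℤ.+ j) ℤ.* (d ℤ.* d) ≡ (i ℤ.* d ℤ.+ j ℤ.* d) ℤ.* d
  lemma = ℤ.solve-∀

/-*-/ : ∀ i j d .{{_ : ℕ.NonZero d}} → (i / 1) ℚ.* (j / d) ≡ (i ℤ.* j) / d
/-*-/ i j d@(suc d-1) = trans (sym (fromℚᵘ-homo-* (mkℚᵘ i 0) (mkℚᵘ j d-1)))
  (ℚ.fromℚᵘ-cong {mkℚᵘ i 0 ℚᵘ.* mkℚᵘ j d-1} {mkℚᵘ (i ℤ.* j) d-1}
    (*≡* (cong (λ e → i ℤ.* j ℤ.* + e) (sym (ℕ.*-identityˡ d)))))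

*-cancelˡ-/ : ∀ m i d .{{_ : ℕ.NonZero m}} .{{_ : ℕ.NonZero d}} .{{_ : ℕ.NonZero (m * d)}} →
              (+ m ℤ.* i) / (m * d) ≡ i / d
*-cancelˡ-/ m@(suc m-1) i d@(suc d-1) =
  ℚ.fromℚᵘ-cong {mkℚᵘ (+ m ℤ.* i) (ℕ.pred (m * d))} {mkℚᵘ i d-1}
    (*≡* (trans (lemma (+ m) i (+ d)) (cong (i ℤ.*_) (sym (ℤ.pos-* m d)))))
  where
  lemma : ∀ m i d → m ℤ.* i ℤ.* d ≡ i ℤ.* (m ℤ.* d)
  lemma = ℤ.solve-∀

/1-^ : ∀ i n → (i / 1) ℚ^.^ n ≡ (i ℤ.^ n) / 1
/1-^ i zero    = refl
/1-^ i (suc n) = trans (cong ((i / 1) ℚ.*_) (/1-^ i n)) (/-*-/ i (i ℤ.^ n) 1)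

-- The exponential generating function.

-- The geometric series: `one ⊖ X` vanishes beyond degree 1, so each coefficient of the inverse
-- repeats the previous one.
inverse-one⊖X : ∀ n → inverse (one ⊖ X) n ≡ 1ℚ
inverse-one⊖X zero    = refl
inverse-one⊖X (suc n) = begin
  ℚ.- (1ℚ ℚ.* ℚΣ.sum {suc n} (λ i → (one ⊖ X) (suc (toℕ i)) ℚ.* Vec.lookup bs i))
    ≡⟨ cong (λ t → ℚ.- (1ℚ ℚ.* ((ℚ.- 1ℚ) ℚ.* Vec.lookup bs zero ℚ.+ t))) tail-vanishes ⟩
  ℚ.- (1ℚ ℚ.* ((ℚ.- 1ℚ) ℚ.* Vec.lookup bs zero ℚ.+ 0ℚ))
    -- Coefficients are stored highest first, so entry `zero` is the one of degree `n`.
    ≡⟨ cong (λ t → ℚ.- (1ℚ ℚ.* ((ℚ.- 1ℚ) ℚ.* t ℚ.+ 0ℚ))) (trans (lookup-zero bs) (inverse-one⊖X n)) ⟩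
  1ℚ ∎
  where
  open ≡-Reasoning
  bs = inverseCoefficients (one ⊖ X) n
  lookup-zero : ∀ {m} (v : Vec.Vec ℚ (suc m)) → Vec.lookup v zero ≡ Vec.head v
  lookup-zero (_ ∷ _) = refl
  tail-vanishes : ℚΣ.sum {n} (λ i → (one ⊖ X) (suc (suc (toℕ i))) ℚ.* Vec.lookup bs (suc i)) ≡ 0ℚ
  tail-vanishes = trans (ℚΣ.sum-cong-≗ {n} λ i → ℚ.*-zeroˡ (Vec.lookup bs (suc i))) (ℚΣ.sum-replicate-zero n)

-- Division by 1 - x turns coefficients into partial sums, and consecutive ones differ by the last
-- term.
⊘-one⊖X-suc : ∀ f n → (f ⊘ (one ⊖ X)) (suc n) ≡ (f ⊘ (one ⊖ X)) n ℚ.+ f (suc n)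
⊘-one⊖X-suc f n = begin
  (f ⊘ (one ⊖ X)) (suc n)                       ≡⟨ partialSum (suc n) ⟩
  ℚΣ.sum {suc (suc n)} (f ∘ toℕ)                ≡⟨ ℚΣ.sum-init-last {suc n} (f ∘ toℕ) ⟩
  ℚΣ.sum {suc n} (f ∘ toℕ ∘ inject₁) ℚ.+ f (toℕ (fromℕ (suc n)))
    ≡⟨ cong₂ ℚ._+_ (ℚΣ.sum-cong-≗ {suc n} (cong f ∘ toℕ-inject₁)) (cong f (toℕ-fromℕ (suc n))) ⟩
  ℚΣ.sum {suc n} (f ∘ toℕ) ℚ.+ f (suc n)        ≡⟨ cong (ℚ._+ f (suc n)) (partialSum n) ⟨
  (f ⊘ (one ⊖ X)) n ℚ.+ f (suc n)               ∎
  where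
  open ≡-Reasoning
  partialSum : ∀ m → (f ⊘ (one ⊖ X)) m ≡ ℚΣ.sum {suc m} (f ∘ toℕ)
  partialSum m = ℚΣ.sum-cong-≗ {suc m} λ i →
    trans (cong (f (toℕ i) ℚ.*_) (inverse-one⊖X (m ∸ toℕ i))) (ℚ.*-identityʳ (f (toℕ i)))

egf-A : ∀ k → egf (A k) ≗ scale (predℤ k / 1) exp ⊘ (one ⊖ X)
egf-A k zero    = refl
egf-A k (suc n) = begin
  + A k (suc n) / suc n !
    ≡⟨ cong (_/ suc n !) (A-recurrence k n) ⟩
  (+ suc n ℤ.* + A k n ℤ.+ c ℤ.^ suc n) / suc n !
    ≡⟨ /-distribʳ-+ (+ suc n ℤ.* + A k n) (c ℤ.^ suc n) (suc n !) ⟩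
  (+ suc n ℤ.* + A k n) / suc n ! ℚ.+ (c ℤ.^ suc n) / suc n !
    -- The factorial `suc n !` unfolds to `suc n * n !`, so the factor of the recurrence cancels.
    ≡⟨ cong₂ ℚ._+_ (*-cancelˡ-/ (suc n) (+ A k n) (n !)) scaled-exp ⟩
  egf (A k) n ℚ.+ scale (c / 1) exp (suc n)
    ≡⟨ cong (ℚ._+ scale (c / 1) exp (suc n)) (egf-A k n) ⟩
  (scale (c / 1) exp ⊘ (one ⊖ X)) n ℚ.+ scale (c / 1) exp (suc n)
    ≡⟨ ⊘-one⊖X-suc (scale (c / 1) exp) n ⟨
  (scale (c / 1) exp ⊘ (one ⊖ X)) (suc n) ∎
  where
  open ≡-Reasoning
  c = predℤ k
  instance
    _ = n ℕ.!≢0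
    _ = suc n ℕ.!≢0
  scaled-exp : (c ℤ.^ suc n) / suc n ! ≡ scale (c / 1) exp (suc n)
  scaled-exp = begin
    (c ℤ.^ suc n) / suc n !                      ≡⟨ cong (_/ suc n !) (ℤ.*-identityʳ (c ℤ.^ suc n)) ⟨
    (c ℤ.^ suc n ℤ.* 1ℤ) / suc n !               ≡⟨ /-*-/ (c ℤ.^ suc n) 1ℤ (suc n !) ⟨
    ((c ℤ.^ suc n) / 1) ℚ.* (1ℤ / suc n !)       ≡⟨ cong (ℚ._* (1ℤ / suc n !)) (/1-^ c (suc n)) ⟨
    scale (c / 1) exp (suc n)                    ∎

proposition2 : (∀ k → A k 0 ≡ 1 × (∀ n → + A k (suc n) ≡ + suc n ℤ.* + A k n ℤ.+ (+ k ℤ.- 1ℤ) ℤ.^ suc n))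
    × (∀ k → egf (A k) ≗ scale ((+ k ℤ.- 1ℤ) / 1) exp ⊘ (one ⊖ X))
    × (∀ k n → A k n ≡ permanent (diagonalOnes k n))
    × (∀ k → A (suc k) ≗ binomialTransform (A k))
proposition2 = (λ k → refl , A-recurrence k) , egf-A , A≡permanent , A-binomialTransform
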